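{- Let $X$ be a set of $n$ individuals such that $\epsilon n\ge 2$ of them are slackers and the rest are workers, where $\epsilon$ is known in advance. Then, for any fixed constant $c\ge 1$, the workers and slackers can be distinguished using $O((1/\epsilon)\log n)$ rounds of random performance-based tests, with $O(n)$ tests per round, in a nonadaptive fashion, with probability at least $1-1/n^{c}$.
   Context: Combinatorial pair testing: the status (worker or slacker) of each individual in $X$ is initially unknown. A performance-based pairwise test $T(x,y)$ on two distinct members $x,y\in X$ returns false if both $x$ and $y$ are slackers, and returns true if at least one of $x,y$ is a worker. Tests are organized in rounds; in each round each member of $X$ may take part in at most one test. An algorithm is nonadaptive if all its tests are specified in advance, before any outcome is seen. Random tests: in each round the tested pairs form a random matching of the members of $X$. Distinguishing the workers and slackers means correctly determining the status of every individual from the test outcomes. The implied constant in the number of rounds may depend on $c$ but not on $n$ or $\epsilon$. -}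

module Defs where

open import Data.Bool.Base using (Bool; not; _∧_)
import Data.Bool.Properties as Bool
open import Data.Fin.Base using (Fin; _<_)
open import Data.Fin.Properties using (_≟_; _<?_; all?)
open import Data.Fin.Subset using (Subset)
open import Data.Integer.Base using (+_; ∣_∣)
open import Data.List.Base
  using (List; []; _∷_; [_]; map; filter; length; allFin; cartesianProduct; cartesianProductWith)
open import Data.Nat.Base using (ℕ; zero; suc)
open import Data.Product.Base using (_×_; _,_; uncurry)
open import Data.Rational.Base as ℚ using (ℚ; 0ℚ; 1ℚ; ↥_; ↧ₙ_)
open import Data.Vec.Base as Vec using (Vec; []; _∷_; lookup)
open import Data.Vec.Properties using (≡-dec)
open import Algebra.Definitions.RawSemiring ℚ.+-*-rawSemiring using (_^_)
open import Level using (Level)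
open import Relation.Binary.PropositionalEquality.Core using (_≡_)
open import Relation.Nullary.Decidable using (_×-dec_; _→-dec_)
open import Relation.Unary using (Pred; Decidable)

private
  variable
    a p : Level
    A : Set a
    n : ℕ

⟦_⟧ : ℕ → ℚ
⟦ k ⟧ = + k ℚ./ 1

-- The individuals are the elements of Fin n, and a population is given by its
-- set of slackers; everyone outside that set is a worker.

performs : Subset n → Fin n → Fin n → Bool
performs slackers x y = not (lookup slackers x ∧ lookup slackers y)

-- A matching is stored as its partner function: lookup m x is the individual
-- paired with x, or x itself when x sits the round out.

Pairing : ℕ → Set
Pairing n = Vec (Fin n) n

IsMatching : Pairing n → Set
IsMatching m = ∀ x → lookup m (lookup m x) ≡ x

-- At most one individual is left out, so the matching is perfect when n is
-- even and misses exactly one individual when n is odd.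

IsMaximum : Pairing n → Set
IsMaximum m = ∀ x y → lookup m x ≡ x → lookup m y ≡ y → x ≡ y

isMatching? : Decidable (IsMatching {n})
isMatching? m = all? λ x → lookup m (lookup m x) ≟ x

isMaximum? : Decidable (IsMaximum {n})
isMaximum? m = all? λ x → all? λ y →
  (lookup m x ≟ x) →-dec ((lookup m y ≟ y) →-dec (x ≟ y))

vectors : List A → (k : ℕ) → List (Vec A k)
vectors xs zero    = [ [] ]
vectors xs (suc k) = cartesianProductWith _∷_ xs (vectors xs k)

-- Each maximum matching occurs exactly once in this list.

matchings : (n : ℕ) → List (Pairing n)
matchings n =
  filter (λ m → isMatching? m ×-dec isMaximum? m) (vectors (allFin n) n)

-- All sequences of R rounds. A uniformly random entry of this list consists
-- of R independent, uniformly random maximum matchings.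

schedules : (n R : ℕ) → List (Vec (Pairing n) R)
schedules n R = vectors (matchings n) R

-- The condition x < y lists each matched pair once and discards x paired
-- with itself.

Test : ℕ → Set
Test n = Fin n × Fin n

tests : Pairing n → List (Test n)
tests {n} m =
  filter (λ (x , y) → (x <? y) ×-dec (lookup m x ≟ y))
         (cartesianProduct (allFin n) (allFin n))

Outcomes : ℕ → Set
Outcomes n = List (Test n × Bool)

outcomes : Subset n → Pairing n → Outcomes n
outcomes slackers m = map (λ t → t , uncurry (performs slackers) t) (tests m)

-- The schedule is drawn before any test is made, so all that remains of a
-- nonadaptive algorithm is how it turns the tests and their outcomes into a
-- set of presumed slackers.

Decoder : ℕ → ℕ → Set
Decoder n R = Vec (Outcomes n) R → Subset n

Distinguishes : ∀ {R} → Decoder n R → Subset n → Vec (Pairing n) R → Set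
Distinguishes decode slackers schedule =
  decode (Vec.map (outcomes slackers) schedule) ≡ slackers

distinguishes? : ∀ {R} (decode : Decoder n R) (slackers : Subset n) →
                 Decidable (Distinguishes decode slackers)
distinguishes? decode slackers schedule =
  ≡-dec Bool._≟_ (decode (Vec.map (outcomes slackers) schedule)) slackers

-- The probability that a uniformly random entry of the list satisfies P.
-- The value on the empty list is a convention.

Pr : {P : Pred A p} → List A → Decidable P → ℚ
Pr []          P? = 0ℚ
Pr xs@(_ ∷ _)  P? = + length (filter P? xs) ℚ./ length xs

-- q ≥ 1 - 1/n^c for c = a/b positive and q ≤ 1. As n^c may be irrational,
-- this is stated as (1 - q)^b · n^a ≤ 1.

_≥1-1/_^_ : ℚ → ℕ → ℚ → Set
q ≥1-1/ n ^ c = ((1ℚ ℚ.- q) ^ ↧ₙ c) ℚ.* (⟦ n ⟧ ^ ∣ ↥ c ∣) ℚ.≤ 1ℚ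

{-# OPTIONS --safe #-}
-- An individual is presumed a slacker exactly when one of its tests fails, so
-- the only possible error is a slacker x that is never paired with another
-- slacker. In a random maximum matching each y ≠ x is the partner of x with
-- probability at least 1/n (exactly 1/n if n is odd), so for s slackers one
-- round misses x with probability β ≤ 1 - (s-1)/n; by Bernoulli's inequality
-- β^k ≤ 1/2 as soon as k s ≥ 2 n. Repeating this 2 (a+1) ⌊log₂ n⌋ times brings
-- the error for x below 1/n^(a+1), where a ≥ c is the numerator of c, and a union
-- bound over x loses a factor n.

module Submission where

open import Defs
open import Data.Bool.Base using (Bool; true; false; not; _∧_)
import Data.Bool.Properties as Bool
open import Data.Fin.Base as Fin using (Fin; zero; suc; toℕ; opposite)
open import Data.Fin.Permutation.Components using (transpose; transpose-inverse)
import Data.Fin.Properties as Fin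
open import Data.Fin.Subset using (Subset; ∣_∣)
import Data.Integer.Base as ℤ
import Data.Integer.Properties as ℤ
open import Data.List.Base as List
  using (List; []; _∷_; _++_; allFin; cartesianProduct; cartesianProductWith; concatMap;
         filter; length; map)
open import Data.List.Membership.Propositional using (_∈_; lose)
open import Data.List.Membership.Propositional.Properties
  using (∈-allFin; ∈-cartesianProduct⁺; ∈-cartesianProduct⁻; ∈-cartesianProductWith⁺;
         ∈-cartesianProductWith⁻; ∈-concatMap⁺; ∈-filter⁺; ∈-filter⁻; ∈-lookup)
open import Data.List.Properties
  using (length-++; length-filter; length-map; length-tabulate)
import Data.List.Relation.Unary.All as All
open import Data.List.Relation.Unary.AllPairs using ([]; _∷_)
open import Data.List.Relation.Unary.Any as Any using (Any; here; there)
import Data.List.Relation.Unary.Any.Properties as Any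
open import Data.List.Relation.Unary.Unique.Propositional using (Unique)
import Data.List.Relation.Unary.Unique.Propositional.Properties as Unique
open import Data.Nat.Base as ℕ using (ℕ; zero; suc; _≤_; _<_; _+_; _*_; _^_; z≤n; s≤s)
import Data.Nat.Coprimality as Coprime
import Data.Nat.DivMod as ℕ
open import Data.Nat.Logarithm using (⌊log₂_⌋; ⌊log₂⌋-mono-≤; ⌊log₂[2^n]⌋≡n)
import Data.Nat.Properties as ℕ
open import Data.Nat.Tactic.RingSolver using (solve-∀)
open import Data.Product.Base using (Σ-syntax; _×_; _,_; proj₁; proj₂)
open import Data.Product.Properties using (,-injective)
open import Data.Rational.Base as ℚ using (ℚ; 0ℚ; 1ℚ; 1/_; NonZero; ↥_; ↧ₙ_)
import Data.Rational.Properties as ℚ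
import Data.Rational.Unnormalised.Base as ℚᵘ
import Data.Rational.Unnormalised.Properties as ℚᵘ
open import Algebra.Definitions.RawSemiring ℚ.+-*-rawSemiring
  using () renaming (_^_ to _ℚ^_)
open import Data.Sum.Base using (_⊎_; inj₁; inj₂)
open import Data.Vec.Base as Vec using (Vec; []; _∷_; lookup; tabulate)
open import Data.Vec.Properties using (lookup∘tabulate; tabulate∘lookup; tabulate-cong; ∷-injective)
import Data.Vec.Relation.Unary.All as VecAll
import Data.Vec.Relation.Unary.Any as VecAny
import Data.Vec.Relation.Unary.Any.Properties as VecAny
open import Function.Base using (_∘_; id)
open import Level using (Level)
open import Relation.Binary.Definitions using (tri<; tri≈; tri>)
open import Relation.Binary.PropositionalEquality
  using (_≡_; _≢_; refl; sym; trans; cong; cong₂; subst; module ≡-Reasoning)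
open import Relation.Nullary.Decidable
  using (does; yes; no; ¬?; dec-true; dec-false; _×-dec_; _⊎-dec_; _→-dec_)
open import Relation.Nullary.Negation using (¬_; contradiction)
open import Relation.Unary using (Pred; Decidable)

private
  variable
    ℓ ℓ′ p : Level
    A : Set ℓ
    B : Set ℓ′
    n : ℕ

-- Counting in lists without duplicates

lookup-injective : {xs : List A} → Unique xs → ∀ i j →
                   List.lookup xs i ≡ List.lookup xs j → i ≡ j
lookup-injective (_ ∷ _)   zero    zero    _  = refl
lookup-injective (x∉ ∷ _)  zero    (suc j) eq = contradiction eq (All.lookup x∉ (∈-lookup j))
lookup-injective (x∉ ∷ _)  (suc i) zero    eq = contradiction (sym eq) (All.lookup x∉ (∈-lookup i))
lookup-injective (_ ∷ xs!) (suc i) (suc j) eq = cong suc (lookup-injective xs! i j eq)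

-- Sending a position of `xs` to the position of its image in `ys` reduces this to the pigeonhole
-- principle on `Fin`. Injectivity is asked only on members of `xs`, since `repair` below is shown
-- injective only on `matchings n`.
length-injection : {xs : List A} {ys : List B} (f : A → B) → Unique xs →
                   (∀ {x} → x ∈ xs → f x ∈ ys) →
                   (∀ {x y} → x ∈ xs → y ∈ xs → f x ≡ f y → x ≡ y) →
                   length xs ≤ length ys
length-injection {xs = xs} {ys} f xs! f∈ f-inj =
  Fin.injective⇒≤ {f = λ i → Any.index (f∈ (∈-lookup i))} λ {i} {j} eq →
    lookup-injective xs! i j (f-inj (∈-lookup i) (∈-lookup j)
      (trans (Any.lookup-index (f∈ (∈-lookup i)))
        (trans (cong (List.lookup ys) eq) (sym (Any.lookup-index (f∈ (∈-lookup j)))))))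

length-⊆ : {xs ys : List A} → Unique xs → (∀ {x} → x ∈ xs → x ∈ ys) → length xs ≤ length ys
length-⊆ xs! xs⊆ys = length-injection id xs! xs⊆ys λ _ _ → id

length-filter-∁ : {P : Pred A p} (P? : Decidable P) (xs : List A) →
                  length xs ≡ length (filter P? xs) + length (filter (¬? ∘ P?) xs)
length-filter-∁ P? []       = refl
length-filter-∁ P? (x ∷ xs) with does (P? x)
... | true  = cong suc (length-filter-∁ P? xs)
... | false = trans (cong suc (length-filter-∁ P? xs)) (sym (ℕ.+-suc _ _))

-- The counting form of the union bound. The weight `c` stays on the left so that a bound of the
-- form `k / c` on each piece can be used without division.
length-concatMap-≤ : (f : A → List B) (c k : ℕ) (xs : List A) →
                     (∀ {x} → x ∈ xs → c * length (f x) ≤ k) →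
                     c * length (concatMap f xs) ≤ length xs * k
length-concatMap-≤ f c k []       _ = ℕ.≤-reflexive (ℕ.*-zeroʳ c)
length-concatMap-≤ f c k (x ∷ xs) h = begin
  c * length (f x ++ concatMap f xs)                ≡⟨ cong (c *_) (length-++ (f x)) ⟩
  c * (length (f x) + length (concatMap f xs))      ≡⟨ ℕ.*-distribˡ-+ c (length (f x)) _ ⟩
  c * length (f x) + c * length (concatMap f xs)
    ≤⟨ ℕ.+-mono-≤ (h (here refl)) (length-concatMap-≤ f c k xs (h ∘ there)) ⟩
  k + length xs * k                                 ∎
  where open ℕ.≤-Reasoning

length-cartesianProductWith : {C : Set ℓ} (f : A → B → C) (xs : List A) (ys : List B) →
                     length (cartesianProductWith f xs ys) ≡ length xs * length ys
length-cartesianProductWith f []       ys = refl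
length-cartesianProductWith f (x ∷ xs) ys =
  trans (length-++ (map (f x) ys)) (cong₂ _+_ (length-map (f x) ys) (length-cartesianProductWith f xs ys))

∈-vectors⁺ : {xs : List A} {k : ℕ} {v : Vec A k} → VecAll.All (_∈ xs) v → v ∈ vectors xs k
∈-vectors⁺ VecAll.[]         = here refl
∈-vectors⁺ (x∈xs VecAll.∷ v) = ∈-cartesianProductWith⁺ _∷_ x∈xs (∈-vectors⁺ v)

∈-vectors⁻ : (xs : List A) (k : ℕ) {v : Vec A k} → v ∈ vectors xs k → VecAll.All (_∈ xs) v
∈-vectors⁻ xs zero    {[]} _ = VecAll.[]
∈-vectors⁻ xs (suc k) v∈
  with _ , _ , x∈xs , w∈ , refl ← ∈-cartesianProductWith⁻ _∷_ xs (vectors xs k) v∈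
  = x∈xs VecAll.∷ ∈-vectors⁻ xs k w∈

vectors-unique : {xs : List A} → Unique xs → ∀ k → Unique (vectors xs k)
vectors-unique xs! zero    = All.[] ∷ []
vectors-unique xs! (suc k) = Unique.cartesianProductWith⁺ _∷_ ∷-injective xs! (vectors-unique xs! k)

length-vectors : (xs : List A) (k : ℕ) → length (vectors xs k) ≡ length xs ^ k
length-vectors xs zero    = refl
length-vectors xs (suc k) =
  trans (length-cartesianProductWith _∷_ xs (vectors xs k)) (cong (length xs *_) (length-vectors xs k))

length-allFin : ∀ n → length (allFin n) ≡ n
length-allFin n = length-tabulate id

-- Maximum matchings

isMaximumMatching? : Decidable (λ (m : Pairing n) → IsMatching m × IsMaximum m)
isMaximumMatching? m = isMatching? m ×-dec isMaximum? m

∈-matchings⁺ : {m : Pairing n} → IsMatching m → IsMaximum m → m ∈ matchings n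
∈-matchings⁺ {n} {m} matching maximum =
  ∈-filter⁺ isMaximumMatching? (∈-vectors⁺ (VecAll.universal ∈-allFin m)) (matching , maximum)

∈-matchings⁻ : {m : Pairing n} → m ∈ matchings n → IsMatching m × IsMaximum m
∈-matchings⁻ {n} m∈ = proj₂ (∈-filter⁻ isMaximumMatching? {xs = vectors (allFin n) n} m∈)

matchings-unique : ∀ n → Unique (matchings n)
matchings-unique n = Unique.filter⁺ isMaximumMatching? (vectors-unique (Unique.allFin⁺ n) n)

-- A fixed point `x` of the order reversal satisfies `2 x + 1 = n`, so there is at most one,
-- whatever the parity of `n`. This witness makes `matchings n` non-empty and so keeps the
-- convention for `Pr` on the empty list out of the result.
reflection : ∀ n → Pairing n
reflection n = tabulate opposite

opposite-fixed : (x : Fin n) → opposite x ≡ x → suc (toℕ x + toℕ x) ≡ n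
opposite-fixed {n} x fixed = begin
  suc (toℕ x) + toℕ x             ≡⟨ cong (λ z → suc (toℕ x) + toℕ z) fixed ⟨
  suc (toℕ x) + toℕ (opposite x)  ≡⟨ cong (suc (toℕ x) +_) (Fin.opposite-prop x) ⟩
  suc (toℕ x) + (n ℕ.∸ suc (toℕ x)) ≡⟨ ℕ.m+[n∸m]≡n (Fin.toℕ<n x) ⟩
  n                               ∎
  where open ≡-Reasoning

double-injective : ∀ {i j} → i + i ≡ j + j → i ≡ j
double-injective {i} {j} eq = ℕ.*-cancelˡ-≡ i j 2
  (trans (cong (i +_) (ℕ.+-identityʳ i)) (trans eq (sym (cong (j +_) (ℕ.+-identityʳ j)))))

reflection∈matchings : ∀ n → reflection n ∈ matchings n
reflection∈matchings n = ∈-matchings⁺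
  (λ x → trans (at _) (trans (cong opposite (at x)) (Fin.opposite-involutive x)))
  (λ x y fx fy → Fin.toℕ-injective (double-injective (ℕ.suc-injective
    (trans (opposite-fixed x (trans (sym (at x)) fx))
           (sym (opposite-fixed y (trans (sym (at y)) fy)))))))
  where
  at : ∀ x → lookup (reflection n) x ≡ opposite x
  at = lookup∘tabulate opposite

transpose-≡ˡ : (i j : Fin n) → transpose i j i ≡ j
transpose-≡ˡ i j rewrite dec-true (i Fin.≟ i) refl = refl

transpose-≡ʳ : (i j : Fin n) → transpose i j j ≡ i
transpose-≡ʳ i j with j Fin.≟ i
... | yes j≡i = j≡i
... | no  _   rewrite dec-true (j Fin.≟ j) refl = refl

transpose-≢ : (i j : Fin n) {k : Fin n} → k ≢ i → k ≢ j → transpose i j k ≡ k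
transpose-≢ i j {k} k≢i k≢j
  rewrite dec-false (k Fin.≟ i) k≢i | dec-false (k Fin.≟ j) k≢j = refl

-- Conjugation by a transposition. The inverse is written with its arguments swapped so that
-- `transpose-inverse` cancels the two directly.
relabel : Fin n → Fin n → Pairing n → Pairing n
relabel i j m = tabulate (transpose i j ∘ lookup m ∘ transpose j i)

lookup-relabel : ∀ i j (m : Pairing n) x →
                 lookup (relabel i j m) x ≡ transpose i j (lookup m (transpose j i x))
lookup-relabel i j m = lookup∘tabulate _

relabel-inverse : ∀ i j (m : Pairing n) → relabel j i (relabel i j m) ≡ m
relabel-inverse i j m = trans (tabulate-cong λ x → begin
  transpose j i (lookup (relabel i j m) (transpose i j x))
    ≡⟨ cong (transpose j i) (lookup-relabel i j m _) ⟩
  transpose j i (transpose i j (lookup m (transpose j i (transpose i j x))))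
    ≡⟨ transpose-inverse j i ⟩
  lookup m (transpose j i (transpose i j x))
    ≡⟨ cong (lookup m) (transpose-inverse j i) ⟩
  lookup m x ∎) (tabulate∘lookup m)
  where open ≡-Reasoning

relabel-matching : ∀ i j {m : Pairing n} → IsMatching m → IsMatching (relabel i j m)
relabel-matching i j {m} matching x = begin
  lookup (relabel i j m) (lookup (relabel i j m) x)
    ≡⟨ cong (lookup (relabel i j m)) (lookup-relabel i j m x) ⟩
  lookup (relabel i j m) (transpose i j (lookup m (transpose j i x)))
    ≡⟨ lookup-relabel i j m _ ⟩
  transpose i j (lookup m (transpose j i (transpose i j (lookup m (transpose j i x)))))
    ≡⟨ cong (transpose i j ∘ lookup m) (transpose-inverse j i) ⟩
  transpose i j (lookup m (lookup m (transpose j i x)))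
    ≡⟨ cong (transpose i j) (matching _) ⟩
  transpose i j (transpose j i x)
    ≡⟨ transpose-inverse i j ⟩
  x ∎
  where open ≡-Reasoning

relabel-fixed : ∀ i j (m : Pairing n) x → lookup (relabel i j m) x ≡ x →
                lookup m (transpose j i x) ≡ transpose j i x
relabel-fixed i j m x fixed = begin
  lookup m (transpose j i x)                                ≡⟨ transpose-inverse j i ⟨
  transpose j i (transpose i j (lookup m (transpose j i x))) ≡⟨ cong (transpose j i) (lookup-relabel i j m x) ⟨
  transpose j i (lookup (relabel i j m) x)                  ≡⟨ cong (transpose j i) fixed ⟩
  transpose j i x                                           ∎
  where open ≡-Reasoning

relabel-maximum : ∀ i j {m : Pairing n} → IsMaximum m → IsMaximum (relabel i j m)
relabel-maximum i j {m} maximum x y fx fy = begin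
  x                               ≡⟨ transpose-inverse i j ⟨
  transpose i j (transpose j i x) ≡⟨ cong (transpose i j)
    (maximum _ _ (relabel-fixed i j m x fx) (relabel-fixed i j m y fy)) ⟩
  transpose i j (transpose j i y) ≡⟨ transpose-inverse i j ⟩
  y                               ∎
  where open ≡-Reasoning

relabel∈matchings : ∀ i j {m : Pairing n} → m ∈ matchings n → relabel i j m ∈ matchings n
relabel∈matchings i j {m} m∈ with matching , maximum ← ∈-matchings⁻ m∈ =
  ∈-matchings⁺ (relabel-matching i j {m} matching) (relabel-maximum i j {m} maximum)

-- Relabelling so that x meets y. If x has the partner z ≠ x, swapping y and z
-- does it. If x is unmatched, then y has a partner w ≠ x, and swapping x and w
-- does it; here w is recovered as the unmatched element of the result.

repair : Fin n → Fin n → Pairing n → Pairing n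
repair x y m with lookup m x Fin.≟ x
... | yes _ = relabel x (lookup m y) m
... | no  _ = relabel (lookup m x) y m

repair∈matchings : ∀ x y {m : Pairing n} → m ∈ matchings n → repair x y m ∈ matchings n
repair∈matchings x y {m} m∈ with lookup m x Fin.≟ x
... | yes _ = relabel∈matchings x (lookup m y) m∈
... | no  _ = relabel∈matchings (lookup m x) y m∈

lookup-repair : ∀ x y {m : Pairing n} → m ∈ matchings n → y ≢ x → lookup (repair x y m) x ≡ y
lookup-repair x y {m} m∈ y≢x with matching , maximum ← ∈-matchings⁻ m∈ | lookup m x Fin.≟ x
... | yes fixed = begin
  lookup (relabel x w m) x                      ≡⟨ lookup-relabel x w m x ⟩
  transpose x w (lookup m (transpose w x x))    ≡⟨ cong (transpose x w ∘ lookup m) (transpose-≡ʳ w x) ⟩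
  transpose x w (lookup m w)                    ≡⟨ cong (transpose x w) (matching y) ⟩
  -- If `y` were its own partner `w`, then `x` and `y` would both be unmatched, and maximality would
  -- identify them.
  transpose x w y                               ≡⟨ transpose-≢ x w y≢x
    (λ y≡w → y≢x (maximum y x (sym y≡w) fixed)) ⟩
  y                                             ∎
  where
  open ≡-Reasoning
  w = lookup m y
... | no z≢x = begin
  lookup (relabel z y m) x                      ≡⟨ lookup-relabel z y m x ⟩
  transpose z y (lookup m (transpose y z x))    ≡⟨ cong (transpose z y ∘ lookup m)
    (transpose-≢ y z (y≢x ∘ sym) (z≢x ∘ sym)) ⟩
  transpose z y z                               ≡⟨ transpose-≡ˡ z y ⟩
  y                                             ∎
  where
  open ≡-Reasoning
  z = lookup m x

-- The hypothesis on the old partner of `x` forces both matchings into the same case of `repair`.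
-- When `x` was matched, it also shows that the same swap was applied to both, and that swap is an
-- involution up to the order of its arguments.
repair-injective : ∀ x y {m m′ : Pairing n} → m ∈ matchings n → m′ ∈ matchings n →
                   lookup m x ≡ lookup m′ x → repair x y m ≡ repair x y m′ → m ≡ m′
repair-injective x y {m} {m′} m∈ m′∈ same eq
  with lookup m x Fin.≟ x | lookup m′ x Fin.≟ x
... | yes fixed | no ¬fixed = contradiction (trans (sym same) fixed) ¬fixed
... | no ¬fixed | yes fixed = contradiction (trans same fixed) ¬fixed
... | no _ | no _ = begin
  m                                                            ≡⟨ relabel-inverse (lookup m x) y m ⟨
  relabel y (lookup m x) (relabel (lookup m x) y m)            ≡⟨ cong₂ (relabel y) same eq ⟩
  relabel y (lookup m′ x) (relabel (lookup m′ x) y m′)         ≡⟨ relabel-inverse (lookup m′ x) y m′ ⟩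
  m′                                                           ∎
  where open ≡-Reasoning
... | yes fixed | yes fixed′ = begin
  m                                                            ≡⟨ relabel-inverse x w m ⟨
  relabel w x (relabel x w m)                                  ≡⟨ cong₂ (λ v → relabel v x) w≡w′ eq ⟩
  relabel w′ x (relabel x w′ m′)                               ≡⟨ relabel-inverse x w′ m′ ⟩
  m′                                                           ∎
  where
  open ≡-Reasoning
  w = lookup m y
  w′ = lookup m′ y
  w-fixed : (m : Pairing _) → lookup m x ≡ x →
            lookup (relabel x (lookup m y) m) (lookup m y) ≡ lookup m y
  w-fixed m fixed =
    trans (lookup-relabel x (lookup m y) m (lookup m y))
      (trans (cong (transpose x (lookup m y) ∘ lookup m) (transpose-≡ˡ (lookup m y) x))
        (trans (cong (transpose x (lookup m y)) fixed) (transpose-≡ˡ x (lookup m y))))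
  -- The swap moves the unmatched place from `x` to `w`. By `eq`, both `w` and `w′` are unmatched in
  -- the same maximum matching.
  w≡w′ : w ≡ w′
  w≡w′ = relabel-maximum x w {m} (proj₂ (∈-matchings⁻ m∈)) w w′ (w-fixed m fixed)
    (trans (cong (λ r → lookup r w′) eq) (w-fixed m′ fixed′))

-- Meetings between slackers

-- Sitting out is stored as being one's own partner, so for a slacker `x` the first condition alone
-- would also hold in rounds where `x` is not tested.
Meets : Subset n → Fin n → Pairing n → Set
Meets s x m = lookup s (lookup m x) ≡ true × lookup m x ≢ x

meets? : (s : Subset n) (x : Fin n) → Decidable (Meets s x)
meets? s x m = (lookup s (lookup m x) Bool.≟ true) ×-dec ¬? (lookup m x Fin.≟ x)

meetings misses : Subset n → Fin n → List (Pairing n)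
meetings s x = filter (meets? s x) (matchings _)
misses   s x = filter (¬? ∘ meets? s x) (matchings _)

isOther? : (s : Subset n) (x : Fin n) → Decidable (λ y → lookup s y ≡ true × y ≢ x)
isOther? s x y = (lookup s y Bool.≟ true) ×-dec ¬? (y Fin.≟ x)

members : Subset n → List (Fin n)
members s = filter (λ y → lookup s y Bool.≟ true) (allFin _)

others : Subset n → Fin n → List (Fin n)
others s x = filter (isOther? s x) (allFin _)

-- The function `f` is arbitrary because the tail of `tabulate f` is `tabulate (f ∘ suc)`; the
-- induction would not go through for `allFin` alone.
∣s∣≤length-filter : {P : Pred A p} (P? : Decidable P) (s : Subset n) (f : Fin n → A) →
                    (∀ i → lookup s i ≡ true → P (f i)) →
                    ∣ s ∣ ≤ length (filter P? (List.tabulate f))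
∣s∣≤length-filter P? []          f h = z≤n
∣s∣≤length-filter P? (true ∷ s)  f h rewrite dec-true (P? (f zero)) (h zero refl) =
  s≤s (∣s∣≤length-filter P? s (f ∘ suc) (h ∘ suc))
∣s∣≤length-filter P? (false ∷ s) f h with does (P? (f zero))
... | true  = ℕ.m≤n⇒m≤1+n (∣s∣≤length-filter P? s (f ∘ suc) (h ∘ suc))
... | false = ∣s∣≤length-filter P? s (f ∘ suc) (h ∘ suc)

∣s∣≤1+others : (s : Subset n) (x : Fin n) → ∣ s ∣ ≤ suc (length (others s x))
∣s∣≤1+others {n} s x = ℕ.≤-trans (∣s∣≤length-filter _ s id λ _ → id)
  (length-⊆ (Unique.filter⁺ _ (Unique.allFin⁺ n)) members⊆)
  where
  members⊆ : ∀ {y} → y ∈ members s → y ∈ x ∷ others s x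
  members⊆ {y} y∈ with y Fin.≟ x
  ... | yes y≡x = here y≡x
  ... | no  y≢x = there (∈-filter⁺ (isOther? s x) (∈-allFin y)
    (proj₂ (∈-filter⁻ (λ y → lookup s y Bool.≟ true) {xs = allFin n} y∈) , y≢x))

-- Double counting: `(y , m)` goes to the old partner of `x` together with the repaired matching.
-- There `y` reappears as the new partner of `x`, and the old partner then determines `m`. Divided
-- out, one round makes `x` meet another slacker with probability at least `o / n`, for `o` other
-- slackers.
others*matchings≤n*meetings : (s : Subset n) (x : Fin n) →
  length (others s x) * length (matchings n) ≤ n * length (meetings s x)
others*matchings≤n*meetings {n} s x = begin
  length (others s x) * length (matchings n)
    ≡⟨ length-cartesianProductWith _,_ (others s x) (matchings n) ⟨
  length (cartesianProduct (others s x) (matchings n))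
    ≤⟨ length-injection (λ (y , m) → lookup m x , repair x y m)
         (Unique.cartesianProduct⁺ (Unique.filter⁺ (isOther? s x) (Unique.allFin⁺ n)) (matchings-unique n))
         into injective ⟩
  length (cartesianProduct (allFin n) (meetings s x))
    ≡⟨ length-cartesianProductWith _,_ (allFin n) (meetings s x) ⟩
  length (allFin n) * length (meetings s x)
    ≡⟨ cong (_* length (meetings s x)) (length-allFin n) ⟩
  n * length (meetings s x) ∎
  where
  open ℕ.≤-Reasoning
  split : ∀ {y m} → (y , m) ∈ cartesianProduct (others s x) (matchings n) →
          (lookup s y ≡ true × y ≢ x) × m ∈ matchings n
  split ym∈ with y∈ , m∈ ← ∈-cartesianProduct⁻ (others s x) (matchings n) ym∈ =
    proj₂ (∈-filter⁻ (isOther? s x) {xs = allFin n} y∈) , m∈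
  into : ∀ {ym} → ym ∈ cartesianProduct (others s x) (matchings n) →
         (lookup (proj₂ ym) x , repair x (proj₁ ym) (proj₂ ym)) ∈ cartesianProduct (allFin n) (meetings s x)
  into {y , m} ym∈ with (sy , y≢x) , m∈ ← split ym∈ =
    ∈-cartesianProduct⁺ (∈-allFin _)
      (∈-filter⁺ (meets? s x) (repair∈matchings x y m∈)
        (subst (λ z → lookup s z ≡ true × z ≢ x) (sym (lookup-repair x y m∈ y≢x)) (sy , y≢x)))
  injective : ∀ {ym ym′} → ym ∈ cartesianProduct (others s x) (matchings n) →
              ym′ ∈ cartesianProduct (others s x) (matchings n) →
              (lookup (proj₂ ym) x , repair x (proj₁ ym) (proj₂ ym)) ≡
              (lookup (proj₂ ym′) x , repair x (proj₁ ym′) (proj₂ ym′)) → ym ≡ ym′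
  injective {y , m} {y′ , m′} ym∈ ym′∈ eq
    with (_ , y≢x) , m∈ ← split ym∈ | (_ , y′≢x) , m′∈ ← split ym′∈
    with same , eq′ ← ,-injective eq
    with refl ← trans (sym (lookup-repair x y m∈ y≢x))
                  (trans (cong (λ r → lookup r x) eq′) (lookup-repair x y′ m′∈ y′≢x))
    = cong (y ,_) (repair-injective x y m∈ m′∈ same eq′)

-- Counting failures

-- In probabilities, a miss has chance at most `2n / (2n + s)`, the shape that `halving` consumes.
-- Two slackers guarantee `s ≤ 2 o`, whence `s M ≤ 2 o N ≤ 2 n G`; adding `2 n M` to both ends gives
-- the claim because `G + M = N`.
2n+s*misses≤2n*matchings : (s : Subset n) (x : Fin n) → 2 ≤ ∣ s ∣ →
  (2 * n + ∣ s ∣) * length (misses s x) ≤ 2 * n * length (matchings n)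
2n+s*misses≤2n*matchings {n} s x 2≤s = begin
  (2 * n + ∣ s ∣) * M            ≡⟨ ℕ.*-distribʳ-+ M (2 * n) ∣ s ∣ ⟩
  2 * n * M + ∣ s ∣ * M          ≤⟨ ℕ.+-monoʳ-≤ (2 * n * M) (ℕ.≤-trans (ℕ.*-mono-≤ s≤2o M≤N) 2oN≤2nG) ⟩
  2 * n * M + 2 * n * G          ≡⟨ ℕ.+-comm (2 * n * M) (2 * n * G) ⟩
  2 * n * G + 2 * n * M          ≡⟨ ℕ.*-distribˡ-+ (2 * n) G M ⟨
  2 * n * (G + M)                ≡⟨ cong (2 * n *_) (length-filter-∁ (meets? s x) (matchings n)) ⟨
  2 * n * N                      ∎
  where
  open ℕ.≤-Reasoning
  G = length (meetings s x)
  M = length (misses s x)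
  N = length (matchings n)
  o = length (others s x)
  M≤N : M ≤ N
  M≤N = length-filter _ (matchings n)
  1≤o : 1 ≤ o
  1≤o = ℕ.s≤s⁻¹ (ℕ.≤-trans 2≤s (∣s∣≤1+others s x))
  s≤2o : ∣ s ∣ ≤ 2 * o
  s≤2o = begin
    ∣ s ∣      ≤⟨ ∣s∣≤1+others s x ⟩
    1 + o      ≤⟨ ℕ.+-mono-≤ 1≤o (ℕ.m≤m+n o 0) ⟩
    2 * o      ∎
  2oN≤2nG : 2 * o * N ≤ 2 * n * G
  2oN≤2nG = begin
    2 * o * N    ≡⟨ ℕ.*-assoc 2 o N ⟩
    2 * (o * N)  ≤⟨ ℕ.*-monoʳ-≤ 2 (others*matchings≤n*meetings s x) ⟩
    2 * (n * G)  ≡⟨ ℕ.*-assoc 2 n G ⟨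
    2 * n * G    ∎

-- Decoding from failed tests

Exposes : Fin n → Test n × Bool → Set
Exposes x ((u , v) , passed) = passed ≡ false × (u ≡ x ⊎ v ≡ x)

exposes? : (x : Fin n) → Decidable (Exposes x)
exposes? x ((u , v) , passed) = (passed Bool.≟ false) ×-dec ((u Fin.≟ x) ⊎-dec (v Fin.≟ x))

exposed? : ∀ {R} (x : Fin n) → Decidable (VecAny.Any (Any (Exposes x)) {R})
exposed? x = VecAny.any? (Any.any? (exposes? x))

presumeExposed : ∀ {n} R → Decoder n R
presumeExposed R os = tabulate λ x → does (exposed? x os)

failed⇒slackers : (s : Subset n) {u v : Fin n} → performs s u v ≡ false →
                  lookup s u ≡ true × lookup s v ≡ true
-- A worker on either side would turn the hypothesis into `true ≡ false`, so only this case remains.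
failed⇒slackers s {u} {v} _ with true ← lookup s u | true ← lookup s v = refl , refl

slackers⇒failed : (s : Subset n) {u v : Fin n} → lookup s u ≡ true → lookup s v ≡ true →
                  performs s u v ≡ false
slackers⇒failed s su sv = cong₂ (λ a b → not (a ∧ b)) su sv

exposed⇒slacker : (s : Subset n) (m : Pairing n) {x : Fin n} →
                  Any (Exposes x) (outcomes s m) → lookup s x ≡ true
exposed⇒slacker s m exposed with Any.satisfied (Any.map⁻ {xs = tests m} exposed)
... | (u , v) , failed , inj₁ refl = proj₁ (failed⇒slackers s {u} {v} failed)
... | (u , v) , failed , inj₂ refl = proj₂ (failed⇒slackers s {u} {v} failed)

isTest? : (m : Pairing n) →
          Decidable (λ (t : Test n) → proj₁ t Fin.< proj₂ t × lookup m (proj₁ t) ≡ proj₂ t)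
isTest? m (x , y) = (x Fin.<? y) ×-dec (lookup m x Fin.≟ y)

∈-tests⁺ : (m : Pairing n) {x y : Fin n} → x Fin.< y → lookup m x ≡ y → (x , y) ∈ tests m
∈-tests⁺ m x<y mx≡y =
  ∈-filter⁺ (isTest? m) (∈-cartesianProduct⁺ (∈-allFin _) (∈-allFin _)) (x<y , mx≡y)

met⇒exposed : (s : Subset n) (m : Pairing n) (x : Fin n) → IsMatching m → lookup s x ≡ true →
              Meets s x m → Any (Exposes x) (outcomes s m)
met⇒exposed s m x matching sx (sy , y≢x) with Fin.<-cmp x (lookup m x)
... | tri< x<y _ _ = Any.map⁺ (lose (∈-tests⁺ m x<y refl) (slackers⇒failed s sx sy , inj₁ refl))
... | tri≈ _ x≡y _ = contradiction (sym x≡y) y≢x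
-- A test is listed with its smaller member first, so here it appears under the partner, whose own
-- partner is `x` by involutivity.
... | tri> _ _ y<x = Any.map⁺ (lose (∈-tests⁺ m y<x (matching x)) (slackers⇒failed s sy sx , inj₂ refl))

-- Errors are one-sided: workers never take part in a failed test, so exposure has to be assumed for
-- slackers only.
presumeExposed-correct : ∀ {R} (s : Subset n) (v : Vec (Pairing n) R) →
  (∀ x → lookup s x ≡ true → VecAny.Any (Any (Exposes x) ∘ outcomes s) v) →
  Distinguishes (presumeExposed R) s v
presumeExposed-correct s v exposed = trans (tabulate-cong agrees) (tabulate∘lookup s)
  where
  agrees : ∀ x → does (exposed? x (Vec.map (outcomes s) v)) ≡ lookup s x
  agrees x with lookup s x in sx
  ... | true  = dec-true (exposed? x _) (VecAny.map⁺ (exposed x sx))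
  ... | false = dec-false (exposed? x (Vec.map (outcomes s) v)) λ e →
    let m , e′ = VecAny.satisfied (VecAny.map⁻ e)
    in contradiction (trans (sym sx) (exposed⇒slacker s m e′)) λ ()

∈-misses⁺ : (s : Subset n) (x : Fin n) {m : Pairing n} → lookup s x ≡ true → m ∈ matchings n →
            ¬ Any (Exposes x) (outcomes s m) → m ∈ misses s x
∈-misses⁺ s x {m} sx m∈ hidden =
  ∈-filter⁺ (¬? ∘ meets? s x) m∈ (hidden ∘ met⇒exposed s m x (proj₁ (∈-matchings⁻ m∈)) sx)

-- Staying hidden constrains every round separately. The schedules hiding `x` therefore lie in a
-- full product of `misses s x`, which is how the independence of the rounds enters the count.
all-misses : ∀ {R} (s : Subset n) (x : Fin n) {v : Vec (Pairing n) R} → lookup s x ≡ true →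
             VecAll.All (_∈ matchings n) v → ¬ VecAny.Any (Any (Exposes x) ∘ outcomes s) v →
             VecAll.All (_∈ misses s x) v
all-misses s x sx VecAll.[]         hidden = VecAll.[]
all-misses s x sx (m∈ VecAll.∷ ms∈) hidden =
  ∈-misses⁺ s x sx m∈ (hidden ∘ VecAny.here) VecAll.∷ all-misses s x sx ms∈ (hidden ∘ VecAny.there)

failures : ∀ (s : Subset n) R → List (Vec (Pairing n) R)
failures s R = filter (¬? ∘ distinguishes? (presumeExposed R) s) (schedules _ R)

-- A schedule that misses several slackers is repeated here. This is harmless, since `length-⊆` asks
-- for uniqueness of the smaller list only.
missed : ∀ (s : Subset n) R → List (Vec (Pairing n) R)
missed s R = concatMap (λ x → vectors (misses s x) R) (members s)

failures⊆missed : ∀ (s : Subset n) R {v} → v ∈ failures s R → v ∈ missed s R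
failures⊆missed {n} s R {v} v∈
  with v∈schedules , fails ← ∈-filter⁻ (¬? ∘ distinguishes? (presumeExposed R) s) {xs = schedules n R} v∈
  -- Exposure is decidable and `Fin n` is finite, so a failure of the decoder yields a concrete
  -- individual at which the criterion breaks.
  with x , hidden ← Fin.¬∀⟶∃¬ n (λ x → lookup s x ≡ true → VecAny.Any (Any (Exposes x) ∘ outcomes s) v)
         (λ x → (lookup s x Bool.≟ true) →-dec VecAny.any? (Any.any? (exposes? x) ∘ outcomes s) v)
         (fails ∘ presumeExposed-correct s v)
  with lookup s x in sx
-- For a worker the implication holds vacuously, so the individual found is a slacker.
... | false = contradiction (λ ()) hidden
... | true  = ∈-concatMap⁺ _ (lose
  (∈-filter⁺ (λ y → lookup s y Bool.≟ true) (∈-allFin x) sx)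
  (∈-vectors⁺ (all-misses s x sx (∈-vectors⁻ (matchings n) R v∈schedules) λ e → hidden λ _ → e)))

-- Geometric decay

-- The inequality `(1 + b/a)^k ≥ 1 + k b/a`, cleared of denominators by the factor `a^(k+1)`.
bernoulli : ∀ a b k → a ^ k * (a + k * b) ≤ (a + b) ^ k * a
bernoulli a b zero    = ℕ.≤-reflexive (cong (1 *_) (ℕ.+-identityʳ a))
bernoulli a b (suc k) = begin
  -- The added term is the quadratic part in `b` that the linear lower bound discards at each step.
  a * a ^ k * (a + (b + k * b))                           ≤⟨ ℕ.m≤m+n _ (a ^ k * (k * b * b)) ⟩
  a * a ^ k * (a + (b + k * b)) + a ^ k * (k * b * b)     ≡⟨ expand a b k (a ^ k) ⟨
  (a + b) * (a ^ k * (a + k * b))                         ≤⟨ ℕ.*-monoʳ-≤ (a + b) (bernoulli a b k) ⟩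
  (a + b) * ((a + b) ^ k * a)                             ≡⟨ ℕ.*-assoc (a + b) ((a + b) ^ k) a ⟨
  (a + b) * (a + b) ^ k * a                               ∎
  where
  open ℕ.≤-Reasoning
  expand : ∀ a b k p → (a + b) * (p * (a + k * b)) ≡ a * p * (a + (b + k * b)) + p * (k * b * b)
  expand = solve-∀

^-distribʳ-* : ∀ a b k → (a * b) ^ k ≡ a ^ k * b ^ k
^-distribʳ-* a b zero    = refl
^-distribʳ-* a b (suc k) =
  trans (cong (a * b *_) (^-distribʳ-* a b k)) (ℕ.[m*n]*[o*p]≡[m*o]*[n*p] a b (a ^ k) (b ^ k))

2*a^k≤[a+b]^k : ∀ a b k .{{_ : ℕ.NonZero a}} → a ≤ k * b → 2 * a ^ k ≤ (a + b) ^ k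
2*a^k≤[a+b]^k a b k a≤kb = ℕ.*-cancelʳ-≤ _ _ a (begin
  2 * a ^ k * a          ≡⟨ regroup a (a ^ k) ⟩
  a ^ k * (a + a)        ≤⟨ ℕ.*-monoʳ-≤ (a ^ k) (ℕ.+-monoʳ-≤ a a≤kb) ⟩
  a ^ k * (a + k * b)    ≤⟨ bernoulli a b k ⟩
  (a + b) ^ k * a        ∎)
  where
  open ℕ.≤-Reasoning
  regroup : ∀ a p → 2 * p * a ≡ p * (a + a)
  regroup = solve-∀

-- The ratio `x / y` is at most `a / (a + b)`, and by Bernoulli `k` factors of the latter are at
-- most one half once `a ≤ k b`. Multiplying through by `a ^ k` avoids fractions.
halving : ∀ a b x y k .{{_ : ℕ.NonZero a}} → a ≤ k * b → (a + b) * x ≤ a * y → 2 * x ^ k ≤ y ^ k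
halving a b x y k a≤kb h = ℕ.*-cancelˡ-≤ (a ^ k) {{ℕ.m^n≢0 a k}} (begin
  a ^ k * (2 * x ^ k)    ≡⟨ swap (a ^ k) (x ^ k) ⟩
  2 * a ^ k * x ^ k      ≤⟨ ℕ.*-monoˡ-≤ (x ^ k) (2*a^k≤[a+b]^k a b k a≤kb) ⟩
  (a + b) ^ k * x ^ k    ≡⟨ ^-distribʳ-* (a + b) x k ⟨
  ((a + b) * x) ^ k      ≤⟨ ℕ.^-monoˡ-≤ k h ⟩
  (a * y) ^ k            ≡⟨ ^-distribʳ-* a y k ⟩
  a ^ k * y ^ k          ∎)
  where
  open ℕ.≤-Reasoning
  swap : ∀ p q → p * (2 * q) ≡ 2 * p * q
  swap = solve-∀

2^j*x^kj≤y^kj : ∀ x y k j → 2 * x ^ k ≤ y ^ k → 2 ^ j * x ^ (k * j) ≤ y ^ (k * j)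
2^j*x^kj≤y^kj x y k j h = begin
  2 ^ j * x ^ (k * j)    ≡⟨ cong (2 ^ j *_) (ℕ.^-*-assoc x k j) ⟨
  2 ^ j * (x ^ k) ^ j    ≡⟨ ^-distribʳ-* 2 (x ^ k) j ⟨
  (2 * x ^ k) ^ j        ≤⟨ ℕ.^-monoˡ-≤ j h ⟩
  (y ^ k) ^ j            ≡⟨ ℕ.^-*-assoc y k j ⟩
  y ^ (k * j)            ∎
  where open ℕ.≤-Reasoning

n<2^[1+⌊log₂n⌋] : ∀ n → n < 2 ^ suc ⌊log₂ n ⌋
n<2^[1+⌊log₂n⌋] n = ℕ.≰⇒> λ 2^≤n → ℕ.1+n≰n
  (subst (_≤ ⌊log₂ n ⌋) (⌊log₂[2^n]⌋≡n (suc ⌊log₂ n ⌋)) (⌊log₂⌋-mono-≤ 2^≤n))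

-- From `2 ≤ n` the rounded logarithm is at least 1, so doubling it absorbs the loss from rounding
-- and no additive term enters the number of rounds.
n≤2^[⌊log₂n⌋*2] : ∀ {n} → 2 ≤ n → n ≤ 2 ^ (⌊log₂ n ⌋ * 2)
n≤2^[⌊log₂n⌋*2] {n} 2≤n = begin
  n                     ≤⟨ ℕ.<⇒≤ (n<2^[1+⌊log₂n⌋] n) ⟩
  2 ^ (1 + ⌊log₂ n ⌋)   ≤⟨ ℕ.^-monoʳ-≤ 2 (ℕ.+-monoˡ-≤ ⌊log₂ n ⌋ (⌊log₂⌋-mono-≤ 2≤n)) ⟩
  2 ^ (⌊log₂ n ⌋ + ⌊log₂ n ⌋) ≡⟨ cong (2 ^_) (double ⌊log₂ n ⌋) ⟩
  2 ^ (⌊log₂ n ⌋ * 2)   ∎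
  where
  open ℕ.≤-Reasoning
  double : ∀ l → l + l ≡ l * 2
  double = solve-∀

-- The remainder is at most `s`, which is at most `(n / s) * s` because the quotient is positive.
-- Rounding down thus costs only a factor 2, while the quotient stays below `1/ε`.
2n≤4[n/s]s : ∀ {n s} .{{_ : ℕ.NonZero s}} → s ≤ n → 2 * n ≤ 4 * (n ℕ./ s) * s
2n≤4[n/s]s {n} {s} s≤n = begin
  2 * n                             ≡⟨ cong (2 *_) (ℕ.m≡m%n+[m/n]*n n s) ⟩
  2 * (n ℕ.% s + n ℕ./ s * s)       ≤⟨ ℕ.*-monoʳ-≤ 2 (ℕ.+-monoˡ-≤ (n ℕ./ s * s) (begin
    n ℕ.% s                           ≤⟨ ℕ.m%n≤n n s ⟩
    s                                 ≡⟨ ℕ.*-identityˡ s ⟨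
    1 * s                             ≤⟨ ℕ.*-monoˡ-≤ s (ℕ.m≥n⇒m/n>0 s≤n) ⟩
    n ℕ./ s * s                       ∎)) ⟩
  2 * (n ℕ./ s * s + n ℕ./ s * s)   ≡⟨ regroup (n ℕ./ s) s ⟩
  4 * (n ℕ./ s) * s                 ∎
  where
  open ℕ.≤-Reasoning
  regroup : ∀ q s → 2 * (q * s + q * s) ≡ 4 * q * s
  regroup = solve-∀

-- The number of rounds and the union bound

rounds : ∀ (a n s : ℕ) .{{_ : ℕ.NonZero s}} → ℕ
-- The first factor is the number of rounds that halves the chance of missing a fixed slacker; the
-- second is the number of halvings that brings it to at most `1 / n^(a+1)`.
rounds a n s = 4 * (n ℕ./ s) * (⌊log₂ n ⌋ * 2 * suc a)

misses-decay : ∀ a (s : Subset n) (x : Fin n) .{{_ : ℕ.NonZero ∣ s ∣}} → 2 ≤ ∣ s ∣ → ∣ s ∣ ≤ n →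
  let R = rounds a n ∣ s ∣ in n ^ suc a * length (misses s x) ^ R ≤ length (matchings n) ^ R
misses-decay {n} a s x 2≤s s≤n = begin
  n ^ suc a * M ^ R       ≤⟨ ℕ.*-monoˡ-≤ (M ^ R) (begin
    n ^ suc a               ≤⟨ ℕ.^-monoˡ-≤ (suc a) (n≤2^[⌊log₂n⌋*2] 2≤n) ⟩
    (2 ^ (L * 2)) ^ suc a   ≡⟨ ℕ.^-*-assoc 2 (L * 2) (suc a) ⟩
    2 ^ (L * 2 * suc a)     ∎) ⟩
  2 ^ (L * 2 * suc a) * M ^ R ≤⟨ 2^j*x^kj≤y^kj M N k (L * 2 * suc a)
    (halving (2 * n) ∣ s ∣ M N k (2n≤4[n/s]s s≤n) (2n+s*misses≤2n*matchings s x 2≤s)) ⟩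
  N ^ R                   ∎
  where
  open ℕ.≤-Reasoning
  M = length (misses s x)
  N = length (matchings n)
  L = ⌊log₂ n ⌋
  k = 4 * (n ℕ./ ∣ s ∣)
  R = rounds a n ∣ s ∣
  2≤n = ℕ.≤-trans 2≤s s≤n
  instance
    2n≢0 : ℕ.NonZero (2 * n)
    2n≢0 = ℕ.m*n≢0 2 n {{_}} {{ℕ.>-nonZero (ℕ.≤-trans (s≤s z≤n) 2≤n)}}

-- There are at most `n` slackers to sum over, and the spare factor `n` in `misses-decay` pays for
-- exactly that.
n^a*failures≤schedules : ∀ a (s : Subset n) .{{_ : ℕ.NonZero ∣ s ∣}} → 2 ≤ ∣ s ∣ → ∣ s ∣ ≤ n →
  let R = rounds a n ∣ s ∣ in n ^ a * length (failures s R) ≤ length (schedules n R)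
n^a*failures≤schedules {n} a s 2≤s s≤n = ℕ.*-cancelˡ-≤ n {{n≢0}} (begin
  n * (n ^ a * length (failures s R))   ≡⟨ ℕ.*-assoc n (n ^ a) _ ⟨
  n ^ suc a * length (failures s R)     ≤⟨ ℕ.*-monoʳ-≤ (n ^ suc a) (length-⊆
    (Unique.filter⁺ (¬? ∘ distinguishes? (presumeExposed R) s) (vectors-unique (matchings-unique n) R))
    (failures⊆missed s R)) ⟩
  n ^ suc a * length (missed s R)       ≤⟨ length-concatMap-≤ _ (n ^ suc a) (N ^ R) (members s) (λ {x} _ →
    subst (λ l → n ^ suc a * l ≤ N ^ R) (sym (length-vectors (misses s x) R))
      (misses-decay a s x 2≤s s≤n)) ⟩
  length (members s) * N ^ R            ≤⟨ ℕ.*-monoˡ-≤ (N ^ R) (length-filter _ (allFin n)) ⟩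
  length (allFin n) * N ^ R             ≡⟨ cong (_* N ^ R) (length-allFin n) ⟩
  n * N ^ R                             ≡⟨ cong (n *_) (length-vectors (matchings n) R) ⟨
  n * length (schedules n R)            ∎)
  where
  open ℕ.≤-Reasoning
  N = length (matchings n)
  R = rounds a n ∣ s ∣
  n≢0 = ℕ.>-nonZero (ℕ.≤-trans (s≤s z≤n) (ℕ.≤-trans 2≤s s≤n))

schedules-nonEmpty : ∀ n R → 0 < length (schedules n R)
schedules-nonEmpty n R = subst (0 <_) (sym (length-vectors (matchings n) R))
  (ℕ.m^n>0 (length (matchings n)) {{ℕ.>-nonZero (nonEmpty (reflection∈matchings n))}} R)
  where
  nonEmpty : {x : A} {xs : List A} → x ∈ xs → 0 < length xs
  nonEmpty (here _)  = s≤s z≤n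
  nonEmpty (there _) = s≤s z≤n

-- The first member determines a test, since the second is its partner under `m`.
length-tests-≤ : (m : Pairing n) → length (tests m) ≤ n
length-tests-≤ {n} m = subst (length (tests m) ≤_) (length-allFin n)
  (length-injection proj₁
    (Unique.filter⁺ (isTest? m) (Unique.cartesianProduct⁺ (Unique.allFin⁺ n) (Unique.allFin⁺ n)))
    (λ _ → ∈-allFin _)
    (λ t∈ t′∈ eq → cong₂ _,_ eq (trans (sym (partner t∈)) (trans (cong (lookup m) eq) (partner t′∈)))))
  where
  partner : ∀ {t} → t ∈ tests m → lookup m (proj₁ t) ≡ proj₂ t
  partner t∈ = proj₂ (proj₂ (∈-filter⁻ (isTest? m) {xs = cartesianProduct (allFin n) (allFin n)} t∈))

-- Rational arithmetic

-- The gcd normalisation inside `⟦ k ⟧` is stuck for a variable `k`. Rewriting to this explicit form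
-- lets the rational operations compute.
⟦⟧-normal : ∀ k → ⟦ k ⟧ ≡ ℚ.mkℚ (ℤ.+ k) 0 (Coprime.sym (Coprime.1-coprimeTo k))
⟦⟧-normal k = ℚ.normalize-coprime (Coprime.sym (Coprime.1-coprimeTo k))

⟦⟧-+ : ∀ i j → ⟦ i + j ⟧ ≡ ⟦ i ⟧ ℚ.+ ⟦ j ⟧
⟦⟧-+ i j rewrite ⟦⟧-normal i | ⟦⟧-normal j | ℤ.*-identityʳ (ℤ.+ i) | ℤ.*-identityʳ (ℤ.+ j) = refl

⟦⟧-* : ∀ i j → ⟦ i * j ⟧ ≡ ⟦ i ⟧ ℚ.* ⟦ j ⟧
⟦⟧-* i j rewrite ⟦⟧-normal i | ⟦⟧-normal j = cong (ℚ._/ 1) (ℤ.pos-* i j)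

⟦⟧-^ : ∀ i k → ⟦ i ^ k ⟧ ≡ ⟦ i ⟧ ℚ^ k
⟦⟧-^ i zero    = refl
⟦⟧-^ i (suc k) = trans (⟦⟧-* i (i ^ k)) (cong (⟦ i ⟧ ℚ.*_) (⟦⟧-^ i k))

⟦⟧-mono : ∀ {i j} → i ≤ j → ⟦ i ⟧ ℚ.≤ ⟦ j ⟧
⟦⟧-mono {i} {j} i≤j rewrite ⟦⟧-normal i | ⟦⟧-normal j =
  ℚ.*≤* (ℤ.*-monoʳ-≤-nonNeg (ℤ.+ 1) (ℤ.+≤+ i≤j))

⟦⟧-nonNegative : ∀ k → ℚ.NonNegative ⟦ k ⟧
⟦⟧-nonNegative k = ℚ.normalize-nonNeg k 1

⟦⟧-positive : ∀ k → 0 < k → ℚ.Positive ⟦ k ⟧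
⟦⟧-positive (suc k) _ = ℚ.normalize-pos (suc k) 1

-- In the unnormalised rationals equality is cross-multiplication, so the reduction to lowest terms
-- never has to be analysed.
/-*-cancel : ∀ k t .{{_ : ℕ.NonZero t}} → (ℤ.+ k ℚ./ t) ℚ.* ⟦ t ⟧ ≡ ⟦ k ⟧
/-*-cancel k t@(suc t′) = ℚ.toℚᵘ-injective (begin
  ℚ.toℚᵘ ((ℤ.+ k ℚ./ t) ℚ.* ⟦ t ⟧)               ≈⟨ ℚ.toℚᵘ-homo-* (ℤ.+ k ℚ./ t) ⟦ t ⟧ ⟩
  ℚ.toℚᵘ (ℤ.+ k ℚ./ t) ℚᵘ.* ℚ.toℚᵘ ⟦ t ⟧
    ≈⟨ ℚᵘ.*-cong (ℚ.toℚᵘ-fromℚᵘ (ℚᵘ.mkℚᵘ (ℤ.+ k) t′)) (ℚ.toℚᵘ-fromℚᵘ (ℚᵘ.mkℚᵘ (ℤ.+ t) 0)) ⟩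
  ℚᵘ.mkℚᵘ (ℤ.+ k) t′ ℚᵘ.* ℚᵘ.mkℚᵘ (ℤ.+ t) 0
    ≈⟨ ℚᵘ.*≡* (trans (ℤ.*-identityʳ _) (cong (λ d → ℤ.+ k ℤ.* ℤ.+ d) (sym (ℕ.*-identityʳ t)))) ⟩
  ℚᵘ.mkℚᵘ (ℤ.+ k) 0                              ≈⟨ ℚ.toℚᵘ-fromℚᵘ (ℚᵘ.mkℚᵘ (ℤ.+ k) 0) ⟨
  ℚ.toℚᵘ ⟦ k ⟧                                   ∎)
  where open ℚᵘ.≃-Reasoning

x^k≤1 : ∀ {x} .{{_ : ℚ.NonNegative x}} → x ℚ.≤ 1ℚ → ∀ k → x ℚ^ k ℚ.≤ 1ℚ
x^[1+k]≤x : ∀ {x} .{{_ : ℚ.NonNegative x}} → x ℚ.≤ 1ℚ → ∀ k → x ℚ^ suc k ℚ.≤ x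

x^k≤1 x≤1 zero    = ℚ.≤-refl
x^k≤1 x≤1 (suc k) = ℚ.≤-trans (x^[1+k]≤x x≤1 k) x≤1

x^[1+k]≤x {x} x≤1 k = ℚ.≤-trans (ℚ.*-monoˡ-≤-nonNeg x (x^k≤1 x≤1 k)) (ℚ.≤-reflexive (ℚ.*-identityʳ x))

-- Scaling by the length of the list turns the failure probability back into a count, ready for the
-- bounds on natural numbers.
Pr-complement : {P : Pred A p} (xs : List A) (P? : Decidable P) → 0 < length xs →
                (1ℚ ℚ.- Pr xs P?) ℚ.* ⟦ length xs ⟧ ≡ ⟦ length (filter (¬? ∘ P?) xs) ⟧
Pr-complement xs@(_ ∷ _) P? _ = begin
  (1ℚ ℚ.- q) ℚ.* ⟦ t ⟧                           ≡⟨ ℚ.*-distribʳ-+ ⟦ t ⟧ 1ℚ (ℚ.- q) ⟩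
  1ℚ ℚ.* ⟦ t ⟧ ℚ.+ (ℚ.- q) ℚ.* ⟦ t ⟧
    ≡⟨ cong₂ ℚ._+_ (ℚ.*-identityˡ ⟦ t ⟧) (sym (ℚ.neg-distribˡ-* q ⟦ t ⟧)) ⟩
  ⟦ t ⟧ ℚ.- q ℚ.* ⟦ t ⟧                          ≡⟨ cong (λ x → ⟦ t ⟧ ℚ.- x) (/-*-cancel g t) ⟩
  ⟦ t ⟧ ℚ.- ⟦ g ⟧
    ≡⟨ cong (λ x → x ℚ.- ⟦ g ⟧) (trans (cong ⟦_⟧ (trans (length-filter-∁ P? xs) (ℕ.+-comm g f))) (⟦⟧-+ f g)) ⟩
  ⟦ f ⟧ ℚ.+ ⟦ g ⟧ ℚ.- ⟦ g ⟧                      ≡⟨ ℚ.+-assoc ⟦ f ⟧ ⟦ g ⟧ (ℚ.- ⟦ g ⟧) ⟩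
  ⟦ f ⟧ ℚ.+ (⟦ g ⟧ ℚ.- ⟦ g ⟧)                    ≡⟨ cong (⟦ f ⟧ ℚ.+_) (ℚ.+-inverseʳ ⟦ g ⟧) ⟩
  ⟦ f ⟧ ℚ.+ 0ℚ                                   ≡⟨ ℚ.+-identityʳ ⟦ f ⟧ ⟩
  ⟦ f ⟧                                          ∎
  where
  open ≡-Reasoning
  t = length xs
  g = length (filter P? xs)
  f = length (filter (¬? ∘ P?) xs)
  q = Pr xs P?

-- With c = a/b the b-th power only helps, since the failure probability is at most 1.
Pr≥1-1/n^c : {P : Pred A p} (xs : List A) (P? : Decidable P) (n : ℕ) (c : ℚ) → 0 < length xs →
             n ^ ℤ.∣ ↥ c ∣ * length (filter (¬? ∘ P?) xs) ≤ length xs → Pr xs P? ≥1-1/ n ^ c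
Pr≥1-1/n^c xs P? n c@record{} t>0 few = begin
  (u ℚ^ ↧ₙ c) ℚ.* (⟦ n ⟧ ℚ^ a)   ≡⟨ cong ((u ℚ^ ↧ₙ c) ℚ.*_) (⟦⟧-^ n a) ⟨
  (u ℚ^ ↧ₙ c) ℚ.* ⟦ n ^ a ⟧      ≤⟨ ℚ.*-monoʳ-≤-nonNeg ⟦ n ^ a ⟧ {{⟦⟧-nonNegative (n ^ a)}}
    (x^[1+k]≤x {{ℚ.nonNegative 0≤u}} u≤1 (ℚ.denominator-1 c)) ⟩
  u ℚ.* ⟦ n ^ a ⟧                ≤⟨ ℚ.*-cancelʳ-≤-pos ⟦ t ⟧ u*n^a*t≤1*t ⟩
  1ℚ                             ∎
  where
  open ℚ.≤-Reasoning
  a = ℤ.∣ ↥ c ∣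
  u = 1ℚ ℚ.- Pr xs P?
  t = length xs
  f = length (filter (¬? ∘ P?) xs)
  instance
    t-positive = ⟦⟧-positive t t>0
  ut≡f : u ℚ.* ⟦ t ⟧ ≡ ⟦ f ⟧
  ut≡f = Pr-complement xs P? t>0
  0≤u : 0ℚ ℚ.≤ u
  0≤u = ℚ.*-cancelʳ-≤-pos ⟦ t ⟧ (begin
    0ℚ ℚ.* ⟦ t ⟧   ≡⟨ ℚ.*-zeroˡ ⟦ t ⟧ ⟩
    0ℚ             ≤⟨ ⟦⟧-mono {0} {f} z≤n ⟩
    ⟦ f ⟧          ≡⟨ ut≡f ⟨
    u ℚ.* ⟦ t ⟧    ∎)
  u≤1 : u ℚ.≤ 1ℚ
  u≤1 = ℚ.*-cancelʳ-≤-pos ⟦ t ⟧ (begin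
    u ℚ.* ⟦ t ⟧    ≡⟨ ut≡f ⟩
    ⟦ f ⟧          ≤⟨ ⟦⟧-mono (length-filter (¬? ∘ P?) xs) ⟩
    ⟦ t ⟧          ≡⟨ ℚ.*-identityˡ ⟦ t ⟧ ⟨
    1ℚ ℚ.* ⟦ t ⟧   ∎)
  u*n^a*t≤1*t : u ℚ.* ⟦ n ^ a ⟧ ℚ.* ⟦ t ⟧ ℚ.≤ 1ℚ ℚ.* ⟦ t ⟧
  u*n^a*t≤1*t = begin
    u ℚ.* ⟦ n ^ a ⟧ ℚ.* ⟦ t ⟧     ≡⟨ cong (ℚ._* ⟦ t ⟧) (ℚ.*-comm u ⟦ n ^ a ⟧) ⟩
    ⟦ n ^ a ⟧ ℚ.* u ℚ.* ⟦ t ⟧     ≡⟨ ℚ.*-assoc ⟦ n ^ a ⟧ u ⟦ t ⟧ ⟩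
    ⟦ n ^ a ⟧ ℚ.* (u ℚ.* ⟦ t ⟧)   ≡⟨ cong (⟦ n ^ a ⟧ ℚ.*_) ut≡f ⟩
    ⟦ n ^ a ⟧ ℚ.* ⟦ f ⟧           ≡⟨ ⟦⟧-* (n ^ a) f ⟨
    ⟦ n ^ a * f ⟧                 ≤⟨ ⟦⟧-mono few ⟩
    ⟦ t ⟧                         ≡⟨ ℚ.*-identityˡ ⟦ t ⟧ ⟨
    1ℚ ℚ.* ⟦ t ⟧                  ∎

-- Since `ε n = s`, the number `n` equals `(1/ε) s`; cancelling `s` from `q s ≤ n` leaves the claim.
q≤1/ε : ∀ n s q (ε : ℚ) .{{_ : NonZero ε}} → ε ℚ.* ⟦ n ⟧ ≡ ⟦ s ⟧ → 0 < s →
        q * s ≤ n → ⟦ q ⟧ ℚ.≤ 1/ ε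
q≤1/ε n s q ε εn≡s s>0 qs≤n = ℚ.*-cancelʳ-≤-pos ⟦ s ⟧ (begin
  ⟦ q ⟧ ℚ.* ⟦ s ⟧          ≡⟨ ⟦⟧-* q s ⟨
  ⟦ q * s ⟧                ≤⟨ ⟦⟧-mono qs≤n ⟩
  ⟦ n ⟧                    ≡⟨ ℚ.*-identityˡ ⟦ n ⟧ ⟨
  1ℚ ℚ.* ⟦ n ⟧             ≡⟨ cong (ℚ._* ⟦ n ⟧) (ℚ.*-inverseˡ ε) ⟨
  1/ ε ℚ.* ε ℚ.* ⟦ n ⟧     ≡⟨ ℚ.*-assoc (1/ ε) ε ⟦ n ⟧ ⟩
  1/ ε ℚ.* (ε ℚ.* ⟦ n ⟧)   ≡⟨ cong (1/ ε ℚ.*_) εn≡s ⟩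
  1/ ε ℚ.* ⟦ s ⟧           ∎)
  where
  open ℚ.≤-Reasoning
  instance
    s-positive = ⟦⟧-positive s s>0

rounds≤ : ∀ a n s (ε : ℚ) .{{_ : NonZero ε}} .{{_ : ℕ.NonZero s}} →
          ε ℚ.* ⟦ n ⟧ ≡ ⟦ s ⟧ →
          ⟦ rounds a n s ⟧ ℚ.≤ ⟦ 8 * suc a ⟧ ℚ.* ((1/ ε) ℚ.* ⟦ ⌊log₂ n ⌋ ⟧)
rounds≤ a n s ε εn≡s = begin
  ⟦ rounds a n s ⟧                           ≡⟨ cong ⟦_⟧ (regroup (n ℕ./ s) L a) ⟩
  ⟦ 8 * suc a * (n ℕ./ s * L) ⟧
    ≡⟨ trans (⟦⟧-* (8 * suc a) (n ℕ./ s * L)) (cong (⟦ 8 * suc a ⟧ ℚ.*_) (⟦⟧-* (n ℕ./ s) L)) ⟩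
  ⟦ 8 * suc a ⟧ ℚ.* (⟦ n ℕ./ s ⟧ ℚ.* ⟦ L ⟧)  ≤⟨ ℚ.*-monoˡ-≤-nonNeg ⟦ 8 * suc a ⟧ {{⟦⟧-nonNegative (8 * suc a)}}
    (ℚ.*-monoʳ-≤-nonNeg ⟦ L ⟧ {{⟦⟧-nonNegative L}}
      (q≤1/ε n s (n ℕ./ s) ε εn≡s (ℕ.>-nonZero⁻¹ s) (ℕ.m/n*n≤m n s))) ⟩
  ⟦ 8 * suc a ⟧ ℚ.* ((1/ ε) ℚ.* ⟦ L ⟧)       ∎
  where
  open ℚ.≤-Reasoning
  L = ⌊log₂ n ⌋
  regroup : ∀ q l a → 4 * q * (l * 2 * suc a) ≡ 8 * suc a * (q * l)
  regroup = solve-∀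

theorem4 : (c : ℚ) → 1ℚ ℚ.≤ c →
    Σ[ C ∈ ℕ ] Σ[ K ∈ ℕ ]
    ((n s : ℕ) (ε : ℚ) .{{_ : NonZero ε}} →
    ε ℚ.* ⟦ n ⟧ ≡ ⟦ s ⟧ → 2 ≤ s → s ≤ n →
    Σ[ R ∈ ℕ ] Σ[ decode ∈ Decoder n R ]
    ( ⟦ R ⟧ ℚ.≤ ⟦ C ⟧ ℚ.* ((1/ ε) ℚ.* ⟦ ⌊log₂ n ⌋ ⟧)
    × ((m : Pairing n) → m ∈ matchings n → length (tests m) ≤ K * n)
    × ((slackers : Subset n) → ∣ slackers ∣ ≡ s →
    Pr (schedules n R) (distinguishes? decode slackers) ≥1-1/ n ^ c)))
-- The 8 is the product of the 4 from halving and the 2 from rounding the logarithm, and `a` depends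
-- on `c` alone. One test per individual is already an upper bound, hence `K = 1`.
theorem4 c _ = 8 * suc a , 1 , λ
  -- Exposing `s` as a successor supplies the `NonZero` instance needed for dividing by `s`.
  { n s@(suc _) ε εn≡s 2≤s s≤n →
    rounds a n s , presumeExposed (rounds a n s) ,
    rounds≤ a n s ε εn≡s ,
    (λ m _ → subst (length (tests m) ≤_) (sym (ℕ.*-identityˡ n)) (length-tests-≤ m)) ,
    λ slackers ∣s∣≡s → bound slackers s ∣s∣≡s 2≤s s≤n }
  where
  a = ℤ.∣ ↥ c ∣
  bound : ∀ {n} (slackers : Subset n) s .{{_ : ℕ.NonZero s}} → ∣ slackers ∣ ≡ s → 2 ≤ s → s ≤ n →
          Pr (schedules n (rounds a n s)) (distinguishes? (presumeExposed (rounds a n s)) slackers) ≥1-1/ n ^ c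
  -- Rounds and decoder were fixed from `s` before the slackers were given; only here is `s`
  -- identified with the size of the set.
  bound {n} slackers _ refl 2≤s s≤n =
    Pr≥1-1/n^c (schedules n R) (distinguishes? (presumeExposed R) slackers) n c
      (schedules-nonEmpty n R) (n^a*failures≤schedules a slackers 2≤s s≤n)
    where R = rounds a n ∣ slackers ∣
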